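{- Every $(P_7,C_7,C_4,\text{diamond})$-free graph $G$ satisfies $\chi(G)\leq \omega(G)+1$.
   Context: All graphs are finite and simple. $P_\ell$ and $C_\ell$ denote the chordless path and chordless cycle on $\ell$ vertices. The diamond is the complete graph on four vertices minus an edge. A graph is $(L_1,L_2,\ldots)$-free if it has no induced subgraph isomorphic to any $L_i$. $\chi(G)$ is the chromatic number and $\omega(G)$ the size of a largest clique of $G$. -}

module Defs where

open import Data.Empty using (⊥-elim)
open import Data.Fin.Base using (Fin; toℕ; finToFun; funToFin)
open import Data.Fin.Patterns using (0F; 1F)
open import Data.Fin.Properties using (any?; all?; finToFun-funToFin) renaming (_≟_ to _≟ᶠ_)
open import Data.Fin.Subset using (Subset; _∈_; ∣_∣; ⊥)
open import Data.Fin.Subset.Properties using (anySubset?; _∈?_; ∉⊥; ∣⊥∣≡0; ∣p∣≤n)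
open import Data.List.Base using (List)
open import Data.List.Relation.Unary.All using (All)
open import Data.Nat.Base using (ℕ; zero; suc; _≤_; z≤n; s≤s; _^_)
open import Data.Nat.Properties using (_≟_; _≤?_; 1+n≢n; ≤-pred; ≤∧≢⇒<)
open import Data.Product.Base using (Σ-syntax; ∃; ∃-syntax; _×_; _,_; proj₁)
open import Data.Sum.Base using (_⊎_; inj₁; inj₂) renaming (swap to swap⊎)
open import Function.Base using (id; _∘_)
open import Function.Bundles using (_⇔_)
open import Function.Definitions using (Injective)
open import Level using (0ℓ)
open import Relation.Binary.Core using (Rel)
open import Relation.Binary.Definitions using (Symmetric; Irreflexive; Decidable)
open import Relation.Binary.PropositionalEquality using (_≡_; _≢_; refl; sym; trans; cong; subst; ≢-sym)
open import Relation.Nullary using (¬_; Dec; yes; no; ¬?; True; toWitness; map′; _×-dec_; _⊎-dec_; _→-dec_)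
open import Relation.Unary using (Pred) renaming (Decidable to Decidable₁)

-- Vertex sets are taken to be Fin n; adjacency is decidable, so that the
-- constructive reading of finite graphs agrees with the classical one.
record Graph : Set₁ where
  field
    order  : ℕ
  V : Set
  V = Fin order
  field
    Adj    : Rel V 0ℓ
    symm   : Symmetric Adj
    irrefl : Irreflexive _≡_ Adj
    adj?   : Decidable Adj

open Graph public using (V)

record _InducedIn_ (H G : Graph) : Set where
  private
    module H = Graph H
    module G = Graph G
  field
    embed     : H.V → G.V
    injective : Injective _≡_ _≡_ embed
    adj⇔      : ∀ i j → H.Adj i j ⇔ G.Adj (embed i) (embed j)

infix 4 _InducedIn_ _-free_

_-free_ : List Graph → Graph → Set₁
Ls -free G = All (λ L → ¬ (L InducedIn G)) Ls

P : ℕ → Graph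
P ℓ = record
  { order  = ℓ
  ; Adj    = λ i j → Next i j ⊎ Next j i
  ; symm   = swap⊎
  ; irrefl = λ { refl (inj₁ e) → 1+n≢n e ; refl (inj₂ e) → 1+n≢n e }
  ; adj?   = λ i j → (suc (toℕ i) ≟ toℕ j) ⊎-dec (suc (toℕ j) ≟ toℕ i)
  }
  where
  Next : Rel (Fin ℓ) 0ℓ
  Next i j = suc (toℕ i) ≡ toℕ j

C : (ℓ : ℕ) → {3≤ℓ : True (3 ≤? ℓ)} → Graph
C ℓ {3≤ℓ} = record
  { order  = ℓ
  ; Adj    = λ i j → Next i j ⊎ Next j i
  ; symm   = swap⊎
  ; irrefl = λ { refl (inj₁ e) → next-irrefl e ; refl (inj₂ e) → next-irrefl e }
  ; adj?   = λ i j → next? i j ⊎-dec next? j i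
  }
  where
  -- successor modulo ℓ
  Next : Rel (Fin ℓ) 0ℓ
  Next i j = suc (toℕ i) ≡ toℕ j ⊎ (suc (toℕ i) ≡ ℓ × toℕ j ≡ 0)

  next? : Decidable Next
  next? i j = (suc (toℕ i) ≟ toℕ j) ⊎-dec ((suc (toℕ i) ≟ ℓ) ×-dec (toℕ j ≟ 0))

  next-irrefl : ∀ {i} → ¬ Next i i
  next-irrefl (inj₁ e) = 1+n≢n e
  next-irrefl (inj₂ (e , z))
    with subst (3 ≤_) (trans (sym e) (cong suc z)) (toWitness 3≤ℓ)
  ... | s≤s ()

K : ℕ → Graph
K n = record
  { order  = n
  ; Adj    = _≢_
  ; symm   = ≢-sym
  ; irrefl = λ i≡j i≢j → i≢j i≡j
  ; adj?   = λ i j → ¬? (i ≟ᶠ j)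
  }

deleteEdge : (G : Graph) → V G → V G → Graph
deleteEdge G u v = record
  { order  = order
  ; Adj    = λ i j → Adj i j × ¬ IsUV i j
  ; symm   = λ { (a , ¬uv) → symm a , ¬uv ∘ swap-uv }
  ; irrefl = λ i≡j → irrefl i≡j ∘ proj₁
  ; adj?   = λ i j → adj? i j ×-dec
               ¬? (((i ≟ᶠ u) ×-dec (j ≟ᶠ v)) ⊎-dec ((i ≟ᶠ v) ×-dec (j ≟ᶠ u)))
  }
  where
  open Graph G using (order; Adj; symm; irrefl; adj?)

  IsUV : Rel (V G) 0ℓ
  IsUV i j = (i ≡ u × j ≡ v) ⊎ (i ≡ v × j ≡ u)

  swap-uv : ∀ {i j} → IsUV i j → IsUV j i
  swap-uv (inj₁ (p , q)) = inj₂ (q , p)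
  swap-uv (inj₂ (p , q)) = inj₁ (q , p)

diamond : Graph
diamond = deleteEdge (K 4) 0F 1F

IsLeast IsGreatest : Pred ℕ 0ℓ → Pred ℕ 0ℓ
IsLeast    Q m = Q m × (∀ k → Q k → m ≤ k)
IsGreatest Q m = Q m × (∀ k → Q k → k ≤ m)

least : ∀ {Q : Pred ℕ 0ℓ} → Decidable₁ Q → ∀ n → Q n → ∃ (IsLeast Q)
least     Q? zero    q = zero , q , λ _ _ → z≤n
least {Q} Q? (suc n) q with Q? zero
... | yes q₀ = zero , q₀ , λ _ _ → z≤n
... | no ¬q₀ with least {Q ∘ suc} (Q? ∘ suc) n q
...   | m , qm , lower = suc m , qm , λ where
          zero    q₀ → ⊥-elim (¬q₀ q₀)
          (suc k) qk → s≤s (lower k qk)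

greatest : ∀ {Q : Pred ℕ 0ℓ} → Decidable₁ Q → Q 0 →
           ∀ n → (∀ k → Q k → k ≤ n) → ∃ (IsGreatest Q)
greatest Q? q₀ zero    upper = zero , q₀ , upper
greatest {Q} Q? q₀ (suc n) upper with Q? (suc n)
... | yes q = suc n , q , upper
... | no ¬q = greatest Q? q₀ n λ k qk →
        ≤-pred (≤∧≢⇒< (upper k qk) λ k≡1+n → ¬q (subst Q k≡1+n qk))

module _ (G : Graph) where
  open Graph G hiding (V)

  ProperColoring : ∀ {k} → (V G → Fin k) → Set
  ProperColoring c = ∀ u v → Adj u v → c u ≢ c v

  Colorable : ℕ → Set
  Colorable k = Σ[ c ∈ (V G → Fin k) ] ProperColoring c

  IsClique : Subset order → Set
  IsClique S = ∀ u v → u ∈ S → v ∈ S → u ≢ v → Adj u v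

  HasClique : ℕ → Set
  HasClique k = ∃[ S ] (IsClique S × ∣ S ∣ ≡ k)

  proper? : ∀ {k} (c : V G → Fin k) → Dec (ProperColoring c)
  proper? c = all? λ u → all? λ v → adj? u v →-dec ¬? (c u ≟ᶠ c v)

  colorable? : Decidable₁ Colorable
  colorable? k = map′
    (λ (x , p) → finToFun x , p)
    (λ (c , p) → funToFin c , λ u v a e → p u v a
      (trans (sym (finToFun-funToFin c u)) (trans e (finToFun-funToFin c v))))
    (any? λ (x : Fin (k ^ order)) → proper? (finToFun x))

  clique? : ∀ S → Dec (IsClique S)
  clique? S = all? λ u → all? λ v →
    (u ∈? S) →-dec ((v ∈? S) →-dec (¬? (u ≟ᶠ v) →-dec adj? u v))

  hasClique? : Decidable₁ HasClique
  hasClique? k = anySubset? λ S → clique? S ×-dec (∣ S ∣ ≟ k)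

  chromaticNumber : ∃ (IsLeast Colorable)
  chromaticNumber = least colorable? order (id , λ u v a u≡v → irrefl u≡v a)

  cliqueNumber : ∃ (IsGreatest HasClique)
  cliqueNumber = greatest hasClique?
    (⊥ , (λ u v u∈⊥ → ⊥-elim (∉⊥ u∈⊥)) , ∣⊥∣≡0 order)
    order λ { _ (S , _ , refl) → ∣p∣≤n S }

  χ : ℕ
  χ = proj₁ chromaticNumber

  ω : ℕ
  ω = proj₁ cliqueNumber

{-# OPTIONS --safe #-}

-- Fix r = ω(G) and colour with r + 1 colours by induction on the order. A vertex
-- of degree at most r can be removed, so let all degrees exceed r. In a
-- (C₄, diamond)-free graph two nonadjacent vertices have at most one common
-- neighbour and the common neighbours of an edge uv span a clique with u and v, so
-- each vertex v has at least two neighbours outside N[u]. Extending an induced path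
-- with this produces C₅ or C₆, and C₆ leads back to C₅. Around a C₅, the absence of
-- P₇ and C₇ makes every vertex that touches the cycle have exactly one neighbour on
-- it, makes those at the same cycle vertex pairwise nonadjacent, and forbids edges
-- from them to vertices that do not touch the cycle. Cycle and neighbours are thus a
-- union of components that maps homomorphically to the Petersen graph; 3-colour it
-- and remove it.
module Submission where

open import Defs
open import Data.Bool.Base using (if_then_else_)
open import Data.Empty using (⊥-elim)
open import Data.Fin.Base using (Fin; zero; suc) renaming (_<_ to _<ᶠ_)
open import Data.Fin.Patterns using (0F; 1F; 2F)
open import Data.Fin.Properties using (any?; all?; <-cmp; injective⇒≤) renaming (_≟_ to _≟ᶠ_)
open import Data.Fin.Subset using (Subset; ⁅_⁆; _-_; ∣_∣) renaming (_∈_ to _∈ₛ_; _∪_ to _∪ₛ_; ⊥ to ∅)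
open import Data.Fin.Subset.Properties
  using (x∈p⇒∣p-x∣<∣p∣; x∈p∧x≢y⇒x∈p-y; x∈p∪q⁺; x∈p∪q⁻; x∈⁅x⁆; x∈⁅y⁆⇒x≡y; ∉⊥)
open import Data.List.Base using (List; _∷_; []; length; lookup; allFin; filter; map; tabulate)
open import Data.List.Membership.Propositional using (_∈_; _∉_; find; lose)
open import Data.List.Membership.DecPropositional using () renaming (_∈?_ to member?)
open import Data.List.Membership.Propositional.Properties
  using (∈-lookup; ∈-filter⁺; ∈-filter⁻; ∈-allFin; ∈-map⁺)
open import Data.List.Membership.Setoid.Properties using (index-injective)
open import Data.List.Properties using (tabulate-lookup; length-tabulate; filter-notAll; length-map)
open import Data.List.Relation.Unary.All as All using (All; []; _∷_)
open import Data.List.Relation.Unary.All.Properties using (all-filter; ¬All⇒Any¬; tabulate⁻)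
open import Data.List.Relation.Unary.AllPairs as AllPairs using (AllPairs; []; _∷_)
import Data.List.Relation.Unary.AllPairs.Properties as AllPairs
open import Data.List.Relation.Unary.Any using (here; there; index)
open import Data.List.Relation.Unary.Any.Properties using (lookup-index)
open import Data.List.Relation.Unary.Unique.Propositional using (Unique)
import Data.List.Relation.Unary.Unique.Propositional.Properties as Unique
open import Data.Nat.Base using (ℕ; zero; suc; _≤_; _<_; _+_; z≤n; s≤s)
open import Data.Nat.Properties using (_≤?_; ≤-refl; ≤-trans; ≤-reflexive; ≤-pred; ≰⇒>; <⇒≱; +-comm)
open import Data.Product.Base using (∃; ∃-syntax; _×_; _,_; proj₁; proj₂)
open import Data.Sum.Base using (_⊎_; inj₁; inj₂)
open import Data.Unit.Base using (⊤; tt)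
open import Data.Vec.Base as Vec using ([]; _∷_)
open import Function.Base using (_∘_; id)
open import Function.Bundles using (_⇔_; mk⇔; Equivalence)
open import Function.Definitions using (Injective)
open import Level using (0ℓ)
open import Relation.Binary.Core using (Rel)
open import Relation.Binary.Definitions using (tri<; tri≈; tri>)
open import Relation.Binary.PropositionalEquality
  using (_≡_; _≢_; refl; sym; cong; subst; subst₂; setoid; ≢-sym)
open import Relation.Nullary
  using (¬_; Dec; yes; no; ¬?; does; True; toWitness; contradiction; _×-dec_; _⊎-dec_)
open import Relation.Nullary.Decidable using (decidable-stable)
open import Relation.Unary using (Pred; _∪_) renaming (Decidable to Decidable₁)

-- Lists without repetition, and counting with them

allPairs-tabulate⁻ : ∀ {A : Set} {R : Rel A 0ℓ} {n} {f : Fin n → A} → AllPairs R (tabulate f) →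
                     ∀ {i j} → i <ᶠ j → R (f i) (f j)
allPairs-tabulate⁻ (r ∷ _)  {zero}  {suc j} _         = tabulate⁻ r j
allPairs-tabulate⁻ (_ ∷ rs) {suc i} {suc j} (s≤s i<j) = allPairs-tabulate⁻ rs i<j

allPairs-lookup : ∀ {A : Set} {R : Rel A 0ℓ} {xs} → AllPairs R xs →
                  ∀ {i j} → i <ᶠ j → R (lookup xs i) (lookup xs j)
allPairs-lookup {R = R} rs = allPairs-tabulate⁻ (subst (AllPairs R) (sym (tabulate-lookup _)) rs)

lookup-injective : ∀ {A : Set} {xs : List A} → Unique xs → Injective _≡_ _≡_ (lookup xs)
lookup-injective xs! {i} {j} eq with <-cmp i j
... | tri< i<j _ _ = contradiction eq (allPairs-lookup xs! i<j)
... | tri≈ _ i≡j _ = i≡j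
... | tri> _ _ j<i = contradiction (sym eq) (allPairs-lookup xs! j<i)

-- Sending each index of `xs` to the position of its entry in `ys` is injective, because the entries
-- of `xs` are distinct.
Unique-⊆⇒length≤ : ∀ {A : Set} {xs ys : List A} → Unique xs → (∀ {x} → x ∈ xs → x ∈ ys) →
                   length xs ≤ length ys
Unique-⊆⇒length≤ xs! xs⊆ys = injective⇒≤ {f = λ i → index (xs⊆ys (∈-lookup i))} λ eq →
  lookup-injective xs! (index-injective (setoid _) (xs⊆ys (∈-lookup _)) (xs⊆ys (∈-lookup _)) eq)

-- The pigeonhole principle. It provides both a neighbour outside a short list and a colour missing
-- around a vertex.
avoid : ∀ {n} {xs ys : List (Fin n)} → Unique xs → length ys < length xs →
        ∃[ x ] (x ∈ xs × x ∉ ys)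
avoid {xs = xs} {ys} xs! ys<xs with All.all? (λ x → member? _≟ᶠ_ x ys) xs
... | yes xs⊆ys = contradiction (Unique-⊆⇒length≤ xs! (All.lookup xs⊆ys)) (<⇒≱ ys<xs)
... | no  xs⊈ys = find (¬All⇒Any¬ (λ x → member? _≟ᶠ_ x ys) xs xs⊈ys)

length≤∣p∣ : ∀ {n} {xs : List (Fin n)} (p : Subset n) → Unique xs → (∀ {x} → x ∈ xs → x ∈ₛ p) →
             length xs ≤ ∣ p ∣
length≤∣p∣ {xs = []}     p xs!           xs⊆p = z≤n
length≤∣p∣ {xs = x ∷ xs} p (x≢xs ∷ xs!) xs⊆p = ≤-trans
  (s≤s (length≤∣p∣ (p - x) xs! λ y∈xs →
    x∈p∧x≢y⇒x∈p-y (xs⊆p (there y∈xs)) (≢-sym (All.lookup x≢xs y∈xs))))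
  (x∈p⇒∣p-x∣<∣p∣ (xs⊆p (here refl)))

fromList : ∀ {n} → List (Fin n) → Subset n
fromList []       = ∅
fromList (x ∷ xs) = ⁅ x ⁆ ∪ₛ fromList xs

∈-fromList⁺ : ∀ {n x} (xs : List (Fin n)) → x ∈ xs → x ∈ₛ fromList xs
∈-fromList⁺ (x ∷ xs) (here refl) = x∈p∪q⁺ (inj₁ (x∈⁅x⁆ x))
∈-fromList⁺ (x ∷ xs) (there y∈xs) = x∈p∪q⁺ (inj₂ (∈-fromList⁺ xs y∈xs))

∈-fromList⁻ : ∀ {n x} (xs : List (Fin n)) → x ∈ₛ fromList xs → x ∈ xs
∈-fromList⁻ []       x∈∅ = ⊥-elim (∉⊥ x∈∅)
∈-fromList⁻ (x ∷ xs) y∈ with x∈p∪q⁻ ⁅ x ⁆ (fromList xs) y∈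
... | inj₁ y∈x  = here (x∈⁅y⁆⇒x≡y x y∈x)
... | inj₂ y∈xs = there (∈-fromList⁻ xs y∈xs)

allPairs-∈ : ∀ {A : Set} {R : Rel A 0ℓ} → (∀ {x y} → R x y → R y x) →
             ∀ {xs} → AllPairs R xs → ∀ {x y} → x ∈ xs → y ∈ xs → x ≢ y → R x y
allPairs-∈ sm (r ∷ rs) (here refl) (here refl) x≢y = contradiction refl x≢y
allPairs-∈ sm (r ∷ rs) (here refl) (there y∈)  x≢y = All.lookup r y∈
allPairs-∈ sm (r ∷ rs) (there x∈)  (here refl) x≢y = sm (All.lookup r x∈)
allPairs-∈ sm (r ∷ rs) (there x∈)  (there y∈)  x≢y = allPairs-∈ sm rs x∈ y∈ x≢y

allPairs-unique : ∀ {A : Set} {P : Pred A 0ℓ} {R : Rel A 0ℓ} →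
                  (∀ {x y} → P x → P y → x ≢ y → R x y) →
                  ∀ {xs} → Unique xs → All P xs → AllPairs R xs
allPairs-unique f []         []       = []
allPairs-unique f (x≢ ∷ xs!) (p ∷ ps) =
  All.zipWith (λ (x≢y , q) → f p q x≢y) (x≢ , ps) ∷ allPairs-unique f xs! ps

-- Induced subgraphs

-- Irreflexivity makes pairwise adjacent entries distinct. The bound `r` is a parameter because it
-- passes to induced subgraphs, whose clique number may drop while the number of colours stays
-- fixed.
CliqueBound : ℕ → Graph → Set
CliqueBound r G = ∀ {xs} → AllPairs (Graph.Adj G) xs → length xs ≤ r

cliqueBound-ω : ∀ G → CliqueBound (ω G) G
cliqueBound-ω G {xs} xs~ = ≤-trans
  (length≤∣p∣ (fromList xs) (AllPairs.map (λ u~v u≡v → irrefl u≡v u~v) xs~)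
    (∈-fromList⁺ xs))
  (proj₂ (proj₂ (cliqueNumber G)) _ (fromList xs ,
    (λ u v u∈ v∈ → allPairs-∈ symm xs~ (∈-fromList⁻ xs u∈) (∈-fromList⁻ xs v∈)) , refl))
  where open Graph G

InducedIn-trans : ∀ {F H G} → F InducedIn H → H InducedIn G → F InducedIn G
InducedIn-trans F⊆H H⊆G = record
  { embed     = H.embed ∘ F.embed
  ; injective = F.injective ∘ H.injective
  ; adj⇔      = λ i j → mk⇔
      (Equivalence.to   (H.adj⇔ _ _) ∘ Equivalence.to (F.adj⇔ i j))
      (Equivalence.from (F.adj⇔ i j) ∘ Equivalence.from (H.adj⇔ _ _))
  }
  where
  module F = _InducedIn_ F⊆H
  module H = _InducedIn_ H⊆G

neighbours : (G : Graph) → V G → List (V G)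
neighbours G v = filter (Graph.adj? G v) (allFin (Graph.order G))

-- Vertices must form some `Fin n`, so an induced subgraph is indexed by the positions in the list
-- of vertices that it keeps.
module Restriction (G : Graph) {Q : Pred (V G) 0ℓ} (Q? : Decidable₁ Q) where
  open Graph G hiding (V)

  members : List (V G)
  members = filter Q? (allFin order)

  restrict : Graph
  restrict = record
    { order  = length members
    ; Adj    = λ i j → Adj (lookup members i) (lookup members j)
    ; symm   = symm
    ; irrefl = λ i≡j → irrefl (cong (lookup members) i≡j)
    ; adj?   = λ i j → adj? (lookup members i) (lookup members j)
    }

  restrict-InducedIn : restrict InducedIn G
  restrict-InducedIn = record
    { embed     = lookup members
    ; injective = lookup-injective (Unique.filter⁺ Q? (Unique.allFin⁺ order))
    ; adj⇔      = λ i j → mk⇔ id id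
    }

  restrict-order : ∀ {v} → ¬ Q v → Graph.order restrict < order
  restrict-order {v} ¬q = subst (length members <_) (length-tabulate id)
    (filter-notAll Q? (allFin order) (lose (∈-allFin v) ¬q))

  restrict-free : ∀ {Ls} → Ls -free G → Ls -free restrict
  restrict-free = All.map λ L⊈G L⊆R → L⊈G (InducedIn-trans L⊆R restrict-InducedIn)

  restrict-cliqueBound : ∀ {r} → CliqueBound r G → CliqueBound r restrict
  restrict-cliqueBound bound {xs} xs~ =
    ≤-trans (≤-reflexive (sym (length-map (lookup members) xs)))
      (bound (AllPairs.map⁺ xs~))

  index-of : ∀ {u} → Q u → V restrict
  index-of q = index (∈-filter⁺ Q? (∈-allFin _) q)

  index-of-proper : ∀ {k} (c : V restrict → Fin k) → ProperColoring restrict c →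
                    ∀ {u w} (p : Q u) (q : Q w) → Adj u w → c (index-of p) ≢ c (index-of q)
  index-of-proper c proper p q u~w = proper _ _ (subst₂ Adj
    (lookup-index (∈-filter⁺ Q? (∈-allFin _) p)) (lookup-index (∈-filter⁺ Q? (∈-allFin _) q)) u~w)

-- Adj is symmetric and irreflexive, so adjacency needs checking on the pairs i < j only.
module _ (H G : Graph) (f : V H → V G) where
  private
    module H = Graph H
    module G = Graph G

  -- For a concrete `H` the test `does` computes, so every entry reduces to an adjacency or a
  -- nonadjacency and an induced copy is given by a triangular table of such facts.
  Pattern : Rel (V H) 0ℓ
  Pattern i j = if does (H.adj? i j) then G.Adj (f i) (f j) else (¬ G.Adj (f i) (f j))

  private
    pattern⇔ : ∀ {i j} → Pattern i j → H.Adj i j ⇔ G.Adj (f i) (f j)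
    pattern⇔ {i} {j} p with H.adj? i j
    ... | yes h = mk⇔ (λ _ → p) (λ _ → h)
    ... | no ¬h = mk⇔ (λ h → contradiction h ¬h) (λ g → contradiction g p)

  pattern-adj⇔ : AllPairs Pattern (allFin H.order) → ∀ i j → H.Adj i j ⇔ G.Adj (f i) (f j)
  pattern-adj⇔ rows i j with <-cmp i j
  ... | tri< i<j _ _ = pattern⇔ (allPairs-tabulate⁻ rows i<j)
  ... | tri≈ _ i≡j _ = mk⇔ (⊥-elim ∘ H.irrefl i≡j) (⊥-elim ∘ G.irrefl (cong f i≡j))
  ... | tri> _ _ j<i = mk⇔ (G.symm ∘ Equivalence.to e ∘ H.symm) (H.symm ∘ Equivalence.from e ∘ G.symm)
    where e = pattern⇔ (allPairs-tabulate⁻ rows j<i)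

  pattern-InducedIn : AllPairs Pattern (allFin H.order) →
                      AllPairs (λ i j → f i ≢ f j) (allFin H.order) → H InducedIn G
  pattern-InducedIn rows distinct = record
    { embed = f ; injective = inj ; adj⇔ = pattern-adj⇔ rows }
    where
    inj : Injective _≡_ _≡_ f
    inj {i} {j} eq with <-cmp i j
    ... | tri< i<j _ _ = contradiction eq (allPairs-tabulate⁻ distinct i<j)
    ... | tri≈ _ i≡j _ = i≡j
    ... | tri> _ _ j<i = contradiction (sym eq) (allPairs-tabulate⁻ distinct j<i)

module _ (H : Graph) where
  open Graph H hiding (V)

  TwinFree : Set
  TwinFree = ∀ i j → i ≡ j ⊎ ∃ λ k → (Adj i k × ¬ Adj j k) ⊎ (Adj j k × ¬ Adj i k)

  twinFree? : Dec TwinFree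
  twinFree? = all? λ i → all? λ j → (i ≟ᶠ j) ⊎-dec any? λ k →
    (adj? i k ×-dec ¬? (adj? j k)) ⊎-dec (adj? j k ×-dec ¬? (adj? i k))

-- Vertices with the same image have the same neighbours, so injectivity comes for free. `P 7` and
-- `C 7` are twin-free; `C 4` and `diamond` are not and go through `pattern-InducedIn`.
pattern-InducedIn-twinFree : ∀ H G {_ : True (twinFree? H)} (f : V H → V G) →
                     AllPairs (Pattern H G f) (allFin (Graph.order H)) → H InducedIn G
pattern-InducedIn-twinFree H G {twinFree} f rows = record
  { embed = f ; injective = inj ; adj⇔ = e }
  where
  e = pattern-adj⇔ H G f rows
  inj : Injective _≡_ _≡_ f
  inj {i} {j} eq with toWitness twinFree i j
  ... | inj₁ i≡j = i≡j
  ... | inj₂ (k , inj₁ (i~k , j≁k)) = contradiction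
    (Equivalence.from (e j k) (subst (λ u → Graph.Adj G u (f k)) eq (Equivalence.to (e i k) i~k))) j≁k
  ... | inj₂ (k , inj₂ (j~k , i≁k)) = contradiction
    (Equivalence.from (e i k) (subst (λ u → Graph.Adj G u (f k)) (sym eq) (Equivalence.to (e j k) j~k))) i≁k

-- Common neighbours in (C₄, diamond)-free graphs

module NoShortCycles (G : Graph) (¬C₄ : ¬ C 4 InducedIn G) (¬diamond : ¬ diamond InducedIn G) where
  open Graph G hiding (V)

  infix 4 _~_ _≁_
  _~_ _≁_ : Rel (V G) 0ℓ
  _~_     = Adj
  u ≁ v = ¬ u ~ v

  ≁-sym : ∀ {u v} → u ≁ v → v ≁ u
  ≁-sym u≁v v~u = u≁v (symm v~u)

  ~⇒≢ : ∀ {u v} → u ~ v → u ≢ v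
  ~⇒≢ u~v u≡v = irrefl u≡v u~v

  apart : ∀ {u v t} → u ~ t → v ≁ t → u ≢ v
  apart u~t v≁t refl = v≁t u~t

  -- Two different common neighbours would induce with `u` and `v` a diamond if adjacent and a C₄
  -- otherwise.
  unique-common : ∀ {u v p q} → u ≢ v → u ≁ v → u ~ p → v ~ p → u ~ q → v ~ q → p ≡ q
  unique-common {u} {v} {p} {q} u≢v u≁v u~p v~p u~q v~q with p ≟ᶠ q | adj? p q
  ... | yes p≡q | _ = p≡q
  ... | no  p≢q | yes p~q = contradiction
    (pattern-InducedIn diamond G (Vec.lookup (u ∷ v ∷ p ∷ q ∷ []))
      ((u≁v ∷ u~p ∷ u~q ∷ []) ∷ (v~p ∷ v~q ∷ []) ∷ (p~q ∷ []) ∷ [] ∷ [])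
      ((u≢v ∷ ~⇒≢ u~p ∷ ~⇒≢ u~q ∷ []) ∷ (~⇒≢ v~p ∷ ~⇒≢ v~q ∷ []) ∷ (p≢q ∷ []) ∷ [] ∷ []))
    ¬diamond
  ... | no  p≢q | no p≁q = contradiction
    (pattern-InducedIn (C 4) G (Vec.lookup (u ∷ p ∷ v ∷ q ∷ []))
      ((u~p ∷ u≁v ∷ u~q ∷ []) ∷ (symm v~p ∷ p≁q ∷ []) ∷ (v~q ∷ []) ∷ [] ∷ [])
      ((~⇒≢ u~p ∷ u≢v ∷ ~⇒≢ u~q ∷ []) ∷ (≢-sym (~⇒≢ v~p) ∷ p≢q ∷ []) ∷ (~⇒≢ v~q ∷ []) ∷ [] ∷ []))
    ¬C₄

  -- Names the single vertex to avoid when a neighbour of `u` is to miss `v`.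
  common-neighbour : ∀ {u v} → u ≢ v → u ≁ v → ∃[ c ] (∀ {n} → u ~ n → v ~ n → n ≡ c)
  common-neighbour {u} {v} u≢v u≁v with any? (λ n → adj? u n ×-dec adj? v n)
  ... | yes (c , u~c , v~c) = c , λ u~n v~n → unique-common u≢v u≁v u~n v~n u~c v~c
  -- With no common neighbour the claim is vacuous and `u` is an arbitrary value.
  ... | no  none            = u , λ u~n v~n → contradiction (_ , u~n , v~n) none

  unrelated : ∀ {u v p n} → u ≢ v → u ≁ v → u ~ p → v ~ p → v ~ n → n ≢ p → u ≁ n
  unrelated u≢v u≁v u~p v~p v~n n≢p u~n = n≢p (unique-common u≢v u≁v u~n v~n u~p v~p)

  -- Short induced cycles

  -- Distinctness of the vertices follows from the stored facts. Pairs are oriented cyclically,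
  -- hence `n₄₁` and `n₅₂`, so that rotating merely renames fields.
  record FiveCycle : Set where
    field
      {v₁ v₂ v₃ v₄ v₅} : V G
      e₁₂ : v₁ ~ v₂
      e₂₃ : v₂ ~ v₃
      e₃₄ : v₃ ~ v₄
      e₄₅ : v₄ ~ v₅
      e₅₁ : v₅ ~ v₁
      n₁₃ : v₁ ≁ v₃
      n₂₄ : v₂ ≁ v₄
      n₃₅ : v₃ ≁ v₅
      n₄₁ : v₄ ≁ v₁
      n₅₂ : v₅ ≁ v₂

  record SixCycle : Set where
    field
      {v₁ v₂ v₃ v₄ v₅ v₆} : V G
      e₁₂ : v₁ ~ v₂
      e₂₃ : v₂ ~ v₃
      e₃₄ : v₃ ~ v₄
      e₄₅ : v₄ ~ v₅
      e₅₆ : v₅ ~ v₆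
      e₆₁ : v₆ ~ v₁
      n₁₃ : v₁ ≁ v₃
      n₂₄ : v₂ ≁ v₄
      n₃₅ : v₃ ≁ v₅
      n₄₆ : v₄ ≁ v₆
      n₅₁ : v₅ ≁ v₁
      n₆₂ : v₆ ≁ v₂
      n₁₄ : v₁ ≁ v₄
      n₂₅ : v₂ ≁ v₅
      n₃₆ : v₃ ≁ v₆

  -- These generate the dihedral symmetries of the cycle, so facts are proved at `v₁` and in one
  -- direction only.
  rotate reflect : FiveCycle → FiveCycle
  rotate c = record
    { e₁₂ = e₂₃ ; e₂₃ = e₃₄ ; e₃₄ = e₄₅ ; e₄₅ = e₅₁ ; e₅₁ = e₁₂
    ; n₁₃ = n₂₄ ; n₂₄ = n₃₅ ; n₃₅ = n₄₁ ; n₄₁ = n₅₂ ; n₅₂ = n₁₃ }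
    where open FiveCycle c
  reflect c = record
    { e₁₂ = symm e₅₁ ; e₂₃ = symm e₄₅ ; e₃₄ = symm e₃₄ ; e₄₅ = symm e₂₃ ; e₅₁ = symm e₁₂
    ; n₁₃ = ≁-sym n₄₁ ; n₂₄ = ≁-sym n₃₅ ; n₃₅ = ≁-sym n₂₄ ; n₄₁ = ≁-sym n₁₃ ; n₅₂ = ≁-sym n₅₂ }
    where open FiveCycle c

  rotate² rotate³ rotate⁴ : FiveCycle → FiveCycle
  rotate² = rotate ∘ rotate
  rotate³ = rotate ∘ rotate²
  rotate⁴ = rotate ∘ rotate³

  -- X, A and Z classify the vertices off the cycle by their neighbours on it:
  -- v₁ alone, v₁ and v₂, or none; Tail leaves adjacency to v₅ open.
  Tail X A Z : FiveCycle → Pred (V G) 0ℓ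
  Tail c u = u ~ v₁ × u ≁ v₂ × u ≁ v₃ × u ≁ v₄                where open FiveCycle c
  X    c u = u ~ v₁ × u ≁ v₂ × u ≁ v₃ × u ≁ v₄ × u ≁ v₅       where open FiveCycle c
  A    c u = u ~ v₁ × u ~ v₂ × u ≁ v₃ × u ≁ v₄ × u ≁ v₅       where open FiveCycle c
  Z    c u = u ≁ v₁ × u ≁ v₂ × u ≁ v₃ × u ≁ v₄ × u ≁ v₅       where open FiveCycle c

  Z? : ∀ c → Decidable₁ (Z c)
  Z? c u = ¬? (adj? u v₁) ×-dec ¬? (adj? u v₂) ×-dec ¬? (adj? u v₃) ×-dec
           ¬? (adj? u v₄) ×-dec ¬? (adj? u v₅)
    where open FiveCycle c

  rotate-Z : ∀ c {u} → Z c u → Z (rotate c) u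
  rotate-Z c (z₁ , z₂ , z₃ , z₄ , z₅) = z₂ , z₃ , z₄ , z₅ , z₁

  rotate²-Z : ∀ c {u} → Z c u → Z (rotate² c) u
  rotate²-Z c u∈Z = rotate-Z (rotate c) (rotate-Z c u∈Z)

  rotate³-Z : ∀ c {u} → Z c u → Z (rotate³ c) u
  rotate³-Z c u∈Z = rotate-Z (rotate² c) (rotate²-Z c u∈Z)

  rotate⁴-Z : ∀ c {u} → Z c u → Z (rotate⁴ c) u
  rotate⁴-Z c u∈Z = rotate-Z (rotate³ c) (rotate³-Z c u∈Z)

  reflect-Z : ∀ c {u} → Z c u → Z (reflect c) u
  reflect-Z c (z₁ , z₂ , z₃ , z₄ , z₅) = z₁ , z₅ , z₄ , z₃ , z₂

  reflect-X : ∀ c {u} → X c u → X (reflect c) u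
  reflect-X c (x₁ , x₂ , x₃ , x₄ , x₅) = x₁ , x₅ , x₄ , x₃ , x₂

  v₁≢v₃ : ∀ c → FiveCycle.v₁ c ≢ FiveCycle.v₃ c
  v₁≢v₃ c = apart (symm e₅₁) n₃₅ where open FiveCycle c

  -- Otherwise `u` and `v₂` would be two common neighbours of `v₁` and `v₃`.
  forward : ∀ c → let open FiveCycle c in ∀ {u} → u ~ v₁ → u ≢ v₂ → u ≁ v₃
  forward c u₁ u≢v₂ u₃ = u≢v₂ (unique-common (v₁≢v₃ c) n₁₃ (symm u₁) (symm u₃) e₁₂ (symm e₂₃))
    where open FiveCycle c

  backward : ∀ c → let open FiveCycle c in ∀ {u} → u ~ v₁ → u ≢ v₅ → u ≁ v₄
  backward c = forward (reflect c)

  -- `u` cannot see both `v₂` and `v₅`, which already share `v₁`. Hence in one of the two directions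
  -- `u`, `v₁` and the next three cycle vertices form an induced path.
  tail : ∀ c → let open FiveCycle c in ∀ {u} → u ~ v₁ → u ≢ v₂ → u ≢ v₅ →
         Tail c u ⊎ Tail (reflect c) u
  tail c {u} u₁ u≢v₂ u≢v₅ with adj? u (FiveCycle.v₂ c)
  ... | no  u₂ = inj₁ (u₁ , u₂ , forward c u₁ u≢v₂ , backward c u₁ u≢v₅)
  ... | yes u₂ = inj₂ (u₁ , backward (rotate c) u₂ (~⇒≢ u₁) , backward c u₁ u≢v₅ , forward c u₁ u≢v₂)
    where open FiveCycle c

  attach : ∀ c → let open FiveCycle c in ∀ {u} → u ~ v₁ → u ≢ v₂ → u ≢ v₅ →
           X c u ⊎ A c u ⊎ A (reflect c) u
  attach c {u} u₁ u≢v₂ u≢v₅ with adj? u (FiveCycle.v₂ c) | adj? u (FiveCycle.v₅ c)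
  ... | no  u₂ | no  u₅ = inj₁ (u₁ , u₂ , forward c u₁ u≢v₂ , backward c u₁ u≢v₅ , u₅)
  ... | no  u₂ | yes u₅ = inj₂ (inj₂ (u₁ , u₅ , backward c u₁ u≢v₅ , forward c u₁ u≢v₂ , u₂))
  ... | yes u₂ | no  u₅ = inj₂ (inj₁ (u₁ , u₂ , forward c u₁ u≢v₂ , backward c u₁ u≢v₅ , u₅))
  ... | yes u₂ | yes u₅ = contradiction u₅ (backward (rotate c) u₂ (~⇒≢ u₁))

  -- `x` and `v₂` are nonadjacent and already share `v₁`.
  X-beside : ∀ c → let open FiveCycle c in ∀ {x n} → X c x → x ~ n → n ≢ v₁ → n ≁ v₂
  X-beside c (x₁ , x₂ , x₃ , _) x~n n≢v₁ = ≁-sym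
    (unrelated (apart e₂₃ x₃) (≁-sym x₂) (symm e₁₂) x₁ x~n n≢v₁)
    where open FiveCycle c

-- Counting-free consequences of all degrees exceeding the clique number.
record Irreducible (G : Graph) : Set where
  open Graph G hiding (V)
  field
    avoid₂ : ∀ v a b → ∃[ n ] (Adj v n × n ≢ a × n ≢ b)
    avoid₃ : ∀ {p q s} → Adj p q → Adj p s → Adj q s →
             ∀ v a b d → ∃[ n ] (Adj v n × n ≢ a × n ≢ b × n ≢ d)
    escape : ∀ {v u} → Adj v u → ∀ w → ∃[ n ] (Adj v n × ¬ Adj u n × n ≢ u × n ≢ w)

-- Vertices around a five-cycle

module Structure (G : Graph) (¬P₇ : ¬ P 7 InducedIn G) (¬C₇ : ¬ C 7 InducedIn G)
                 (¬C₄ : ¬ C 4 InducedIn G) (¬diamond : ¬ diamond InducedIn G)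
                 (irreducible : Irreducible G) where
  open Graph G hiding (V)
  open NoShortCycles G ¬C₄ ¬diamond
  open Irreducible irreducible

  no-P₇ : ∀ a b c d e f g →
          ¬ AllPairs (Pattern (P 7) G (Vec.lookup (a ∷ b ∷ c ∷ d ∷ e ∷ f ∷ g ∷ []))) (allFin 7)
  no-P₇ a b c d e f g rows = ¬P₇ (pattern-InducedIn-twinFree (P 7) G _ rows)

  no-C₇ : ∀ a b c d e f g →
          ¬ AllPairs (Pattern (C 7) G (Vec.lookup (a ∷ b ∷ c ∷ d ∷ e ∷ f ∷ g ∷ []))) (allFin 7)
  no-C₇ a b c d e f g rows = ¬C₇ (pattern-InducedIn-twinFree (C 7) G _ rows)

  -- If `z′` missed `n`, then `z′`, `z`, `n` would prolong `v₁v₂v₃v₄` to an induced P₇.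
  Z-tail : ∀ c {z z′ n} → Z c z → Z c z′ → z ~ z′ → z ~ n → Tail c n → z′ ~ n
  Z-tail c {z} {z′} {n} (z₁ , z₂ , z₃ , z₄ , _) (z′₁ , z′₂ , z′₃ , z′₄ , _) z~z′ z~n (n₁ , n₂ , n₃ , n₄)
    with adj? z′ n
  ... | yes z′~n = z′~n
  ... | no  z′≁n = ⊥-elim (no-P₇ z′ z n v₁ v₂ v₃ v₄
    ( (symm z~z′ ∷ z′≁n ∷ z′₁ ∷ z′₂ ∷ z′₃ ∷ z′₄ ∷ [])
    ∷ (z~n ∷ z₁ ∷ z₂ ∷ z₃ ∷ z₄ ∷ [])
    ∷ (n₁ ∷ n₂ ∷ n₃ ∷ n₄ ∷ [])
    ∷ (e₁₂ ∷ n₁₃ ∷ ≁-sym n₄₁ ∷ [])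
    ∷ (e₂₃ ∷ n₂₄ ∷ [])
    ∷ (e₃₄ ∷ [])
    ∷ [] ∷ []))
    where open FiveCycle c

  Z-attach : ∀ c {z z′ n} → Z c z → Z c z′ → z ~ z′ → z ~ n → n ~ FiveCycle.v₁ c → z′ ~ n
  Z-attach c z∈Z@(_ , z₂ , _ , _ , z₅) z′∈Z z~z′ z~n n₁
    with tail c n₁ (apart (symm z~n) (≁-sym z₂)) (apart (symm z~n) (≁-sym z₅))
  ... | inj₁ n∈T = Z-tail c z∈Z z′∈Z z~z′ z~n n∈T
  ... | inj₂ n∈T = Z-tail (reflect c) (reflect-Z c z∈Z) (reflect-Z c z′∈Z) z~z′ z~n n∈T

  -- If `n` touched the cycle at any vertex, `Z-attach` for the cycle rotated to that vertex would
  -- give `z′ ~ n`.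
  Z-spread : ∀ c {z z′ n} → Z c z → Z c z′ → z ~ z′ → z ~ n → z′ ≁ n → Z c n
  Z-spread c {z} {z′} z∈Z z′∈Z z~z′ z~n z′≁n =
    go c z∈Z z′∈Z ,
    go (rotate c) (rotate-Z c z∈Z) (rotate-Z c z′∈Z) ,
    go (rotate² c) (rotate²-Z c z∈Z) (rotate²-Z c z′∈Z) ,
    go (rotate³ c) (rotate³-Z c z∈Z) (rotate³-Z c z′∈Z) ,
    go (rotate⁴ c) (rotate⁴-Z c z∈Z) (rotate⁴-Z c z′∈Z)
    where
    go : ∀ d → Z d z → Z d z′ → _ ≁ FiveCycle.v₁ d
    go d z∈ z′∈ n₁ = z′≁n (Z-attach d z∈ z′∈ z~z′ z~n n₁)

  -- Otherwise every neighbour of z that touches the cycle is adjacent to z′, and every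
  -- neighbour of z in Z is adjacent to y, hence to z′: all of N(z) lies in N[z′].
  Z-isolated : ∀ c {z z′ y} → Z c z → Z c z′ → z ~ z′ → z ~ y → y ≁ FiveCycle.v₁ c
  Z-isolated c {z} z∈Z z′∈Z z~z′ z~y y₁ =
    let n , z~n , z′≁n , n≢z′ , _ = escape z~z′ z
        n∈Z = Z-spread c z∈Z z′∈Z z~z′ z~n z′≁n
    in ~⇒≢ z~y (unique-common (≢-sym n≢z′) z′≁n (symm z~z′) (symm z~n)
         (Z-attach c z∈Z z′∈Z z~z′ z~y y₁) (Z-attach c z∈Z n∈Z z~n z~y y₁))

  -- If `y` sees neither `x` nor `z`, or `z` alone, then `y v₃ v₄ v₅ v₁ x z` is an induced P₇ or C₇;
  -- if it sees `x` alone, `v₅ v₄ v₃ y x z w` is an induced P₇. All of these bypass `v₂`, so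
  -- adjacency of `y` to `v₂` stays open; `fork-impossible` relies on this when it rotates the fork.
  fork : ∀ c → let open FiveCycle c in ∀ {z x w y} → Z c z → X c x → X (rotate c) w → z ~ x → z ~ w →
         y ~ v₃ → y ≢ v₂ → y ≁ v₄ → y ≢ v₄ → y ~ x × y ~ z
  fork c {z} {x} {w} {y} (z₁ , z₂ , z₃ , z₄ , z₅)
       x∈X@(x₁ , x₂ , x₃ , x₄ , x₅) w∈X@(w₂ , w₃ , w₄ , w₅ , w₁) z~x z~w y₃ y≢v₂ y₄ y≢v₄ =
    result (adj? y x) (adj? y z)
    where
    open FiveCycle c
    y₁ = backward (rotate² c) y₃ y≢v₂
    y₅ = forward (rotate² c) y₃ y≢v₄
    y≁w : y ≁ w
    y≁w y~w = X-beside (rotate c) w∈X (symm y~w) y≢v₂ y₃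
    x≁w : x ≁ w
    x≁w x~w = X-beside c x∈X x~w (≢-sym (apart (symm e₅₁) w₅)) w₂
    result : Dec (y ~ x) → Dec (y ~ z) → y ~ x × y ~ z
    result (yes y~x) (yes y~z) = y~x , y~z
    result (yes y~x) (no  y≁z) = ⊥-elim (no-P₇ v₅ v₄ v₃ y x z w
      ( (symm e₄₅ ∷ ≁-sym n₃₅ ∷ ≁-sym y₅ ∷ ≁-sym x₅ ∷ ≁-sym z₅ ∷ ≁-sym w₅ ∷ [])
      ∷ (symm e₃₄ ∷ ≁-sym y₄ ∷ ≁-sym x₄ ∷ ≁-sym z₄ ∷ ≁-sym w₄ ∷ [])
      ∷ (symm y₃ ∷ ≁-sym x₃ ∷ ≁-sym z₃ ∷ ≁-sym w₃ ∷ [])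
      ∷ (y~x ∷ y≁z ∷ y≁w ∷ [])
      ∷ (symm z~x ∷ x≁w ∷ [])
      ∷ (z~w ∷ [])
      ∷ [] ∷ []))
    result (no y≁x) (no y≁z) = ⊥-elim (no-P₇ y v₃ v₄ v₅ v₁ x z
      ( (y₃ ∷ y₄ ∷ y₅ ∷ y₁ ∷ y≁x ∷ y≁z ∷ [])
      ∷ (e₃₄ ∷ n₃₅ ∷ ≁-sym n₁₃ ∷ ≁-sym x₃ ∷ ≁-sym z₃ ∷ [])
      ∷ (e₄₅ ∷ n₄₁ ∷ ≁-sym x₄ ∷ ≁-sym z₄ ∷ [])
      ∷ (e₅₁ ∷ ≁-sym x₅ ∷ ≁-sym z₅ ∷ [])
      ∷ (symm x₁ ∷ ≁-sym z₁ ∷ [])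
      ∷ (symm z~x ∷ [])
      ∷ [] ∷ []))
    result (no y≁x) (yes y~z) = ⊥-elim (no-C₇ y v₃ v₄ v₅ v₁ x z
      ( (y₃ ∷ y₄ ∷ y₅ ∷ y₁ ∷ y≁x ∷ y~z ∷ [])
      ∷ (e₃₄ ∷ n₃₅ ∷ ≁-sym n₁₃ ∷ ≁-sym x₃ ∷ ≁-sym z₃ ∷ [])
      ∷ (e₄₅ ∷ n₄₁ ∷ ≁-sym x₄ ∷ ≁-sym z₄ ∷ [])
      ∷ (e₅₁ ∷ ≁-sym x₅ ∷ ≁-sym z₅ ∷ [])
      ∷ (symm x₁ ∷ ≁-sym z₁ ∷ [])
      ∷ (symm z~x ∷ [])
      ∷ [] ∷ []))

  -- The edge v₃v₄ leaves v₃ a neighbour n outside N[v₄], adjacent to x and z by `fork`; as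
  -- n ∈ X₃ and w also form a fork at z, the same argument rules out a fourth neighbour of v₃.
  fork-impossible : ∀ c {z x w} → Z c z → X c x → X (rotate c) w → z ~ x → z ≁ w
  fork-impossible c {z} {x} {w} z∈Z@(_ , _ , z₃ , z₄ , _) x∈X w∈X z~x z~w =
    let n , v₃~n , v₄≁n , n≢v₄ , n≢v₂ = escape e₃₄ v₂
        n~x , n~z = fork c z∈Z x∈X w∈X z~x z~w (symm v₃~n) n≢v₂ (≁-sym v₄≁n) n≢v₄
        n∈X : X (rotate² c) n
        n∈X = symm v₃~n , ≁-sym v₄≁n
            , forward (rotate² c) (symm v₃~n) n≢v₄ , backward (rotate² c) (symm v₃~n) n≢v₂
            , X-beside c x∈X (symm n~x) (apart (symm v₃~n) n₁₃)
        m , v₃~m , m≢v₂ , m≢v₄ , m≢n = avoid₃ n~x n~z (symm z~x) v₃ v₂ v₄ n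
        m~v₄ = decidable-stable (adj? m v₄) λ m₄ →
          let _ , m~z = fork c z∈Z x∈X w∈X z~x z~w (symm v₃~m) m≢v₂ m₄ m≢v₄
          in m≢n (unique-common (apart e₃₄ z₄) (≁-sym z₃) v₃~m (symm m~z) v₃~n (symm n~z))
        m~w , _ = fork (rotate c) (rotate-Z c z∈Z) w∈X n∈X z~w (symm n~z)
          m~v₄ (≢-sym (~⇒≢ v₃~m)) (forward (rotate² c) (symm v₃~m) m≢v₄) (apart (symm v₃~m) (≁-sym n₃₅))
    in X-beside (rotate c) w∈X (symm m~w) m≢v₂ (symm v₃~m)
    where open FiveCycle c

  -- The Z-neighbour z of a ∈ A₁ meets N(v₁) ∪ N(v₂) in a only, so two of the four
  -- neighbours that z must have lie in X₄ and X₅.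
  A-Z : ∀ c {a z} → A c a → Z c z → a ≁ z
  A-Z c {a} {z} (a₁ , a₂ , _) z∈Z@(z₁ , z₂ , z₃ , z₄ , z₅) a~z =
    let n , z~n , n≢a , n≢c₃ , n≢c₄ = avoid₃ a₁ a₂ e₁₂ z a c₃ c₄
        m , z~m , m≢a , m≢c₃ , m≢c₅ = avoid₃ a₁ a₂ e₁₂ z a c₃ c₅
        n₁ = off₁ z~n n≢a
        m₁ = off₁ z~m m≢a
        n₂ = off₂ z~n n≢a
        m₂ = off₂ z~m m≢a
        n₃ = λ e → n≢c₃ (only₃ z~n (symm e))
        m₃ = λ e → m≢c₃ (only₃ z~m (symm e))
        n₄ = λ e → n≢c₄ (only₄ z~n (symm e))
        m₅ = λ e → m≢c₅ (only₅ z~m (symm e))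
        n₅ = decidable-stable (adj? n v₅) λ n₅ →
          Z-isolated c z∈Z (n₁ , n₂ , n₃ , n₄ , n₅) z~n (symm a~z) a₁
        m₄ = decidable-stable (adj? m v₄) λ m₄ →
          Z-isolated c z∈Z (m₁ , m₂ , m₃ , m₄ , m₅) z~m (symm a~z) a₁
    in fork-impossible (rotate³ c) (rotate³-Z c z∈Z)
         (m₄ , m₅ , m₁ , m₂ , m₃) (n₅ , n₁ , n₂ , n₃ , n₄) z~m z~n
    where
    open FiveCycle c
    off₁ : ∀ {n} → z ~ n → n ≢ a → n ≁ v₁
    off₁ z~n n≢a = ≁-sym (unrelated (apart e₁₂ z₂) (≁-sym z₁) (symm a₁) (symm a~z) z~n n≢a)
    off₂ : ∀ {n} → z ~ n → n ≢ a → n ≁ v₂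
    off₂ z~n n≢a = ≁-sym (unrelated (apart e₂₃ z₃) (≁-sym z₂) (symm a₂) (symm a~z) z~n n≢a)
    common : ∀ {v t} → v ~ t → z ≁ v → z ≁ t → ∃[ c ] (∀ {n} → z ~ n → v ~ n → n ≡ c)
    common v~t z≁v z≁t = common-neighbour (≢-sym (apart v~t z≁t)) z≁v
    c₃ = proj₁ (common e₃₄ z₃ z₄)
    c₄ = proj₁ (common e₄₅ z₄ z₅)
    c₅ = proj₁ (common e₅₁ z₅ z₁)
    only₃ : ∀ {n} → z ~ n → v₃ ~ n → n ≡ c₃
    only₃ = proj₂ (common e₃₄ z₃ z₄)
    only₄ : ∀ {n} → z ~ n → v₄ ~ n → n ≡ c₄
    only₄ = proj₂ (common e₄₅ z₄ z₅)
    only₅ : ∀ {n} → z ~ n → v₅ ~ n → n ≡ c₅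
    only₅ = proj₂ (common e₅₁ z₅ z₁)

  -- Let `n` be a neighbour of `a` outside N[v₁] and different from the common neighbour of `a` and
  -- `v₄`. A contact of `n` with `v₂`, `v₃` or `v₅` would create a second common neighbour of a
  -- nonadjacent pair, so `n` lies in Z, against `A-Z`.
  A-empty : ∀ c {a} → ¬ A c a
  A-empty c {a} a∈A@(a₁ , a₂ , a₃ , a₄ , a₅) =
    let c₄ , only₄ = common-neighbour (apart a₁ n₄₁) a₄
        n , a~n , v₁≁n , n≢v₁ , n≢c₄ = escape a₁ c₄
        n₂ = λ n₂ → ~⇒≢ a₂ (unique-common n≢v₁ (≁-sym v₁≁n) (symm a~n) (symm a₁) n₂ e₁₂)
        n₃ = beside₃ a~n λ { refl → v₁≁n e₁₂ }
        n₅ = beside₅ a~n n≢v₁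
        n∈Z : Z c n
        n∈Z = ≁-sym v₁≁n , n₂ , n₃ , (λ n₄ → n≢c₄ (only₄ a~n (symm n₄))) , n₅
    in A-Z c a∈A n∈Z a~n
    where
    open FiveCycle c
    beside₃ : ∀ {n} → a ~ n → n ≢ v₂ → n ≁ v₃
    beside₃ a~n n≢v₂ = ≁-sym (unrelated (apart e₃₄ a₄) (≁-sym a₃) (symm e₂₃) a₂ a~n n≢v₂)
    beside₅ : ∀ {n} → a ~ n → n ≢ v₁ → n ≁ v₅
    beside₅ a~n n≢v₁ = ≁-sym (unrelated (apart (symm e₄₅) a₄) (≁-sym a₅) e₅₁ a₁ a~n n≢v₁)

  attach-X : ∀ c → let open FiveCycle c in ∀ {u} → u ~ v₁ → u ≢ v₂ → u ≢ v₅ → X c u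
  attach-X c u₁ u≢v₂ u≢v₅ with attach c u₁ u≢v₂ u≢v₅
  ... | inj₁ u∈X        = u∈X
  ... | inj₂ (inj₁ u∈A) = ⊥-elim (A-empty c u∈A)
  ... | inj₂ (inj₂ u∈A) = ⊥-elim (A-empty (reflect c) u∈A)

  -- A neighbour of `z` other than `x` misses `v₁`, misses `v₂` and `v₅` by `fork-impossible`, and
  -- is not in Z by `Z-isolated`, so it sees `v₃` or `v₄`. Avoiding the common neighbour of `z` with
  -- either one gives `n` at `v₄` and `m` at `v₃`, again a fork.
  X-Z : ∀ c {x z} → X c x → Z c z → x ≁ z
  X-Z c {x} {z} x∈X@(x₁ , _) z∈Z@(z₁ , z₂ , z₃ , z₄ , z₅) x~z =
    let c₃ , only₃ = common-neighbour (≢-sym (apart e₃₄ z₄)) z₃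
        c₄ , only₄ = common-neighbour (≢-sym (apart e₄₅ z₅)) z₄
        n , z~n , n≢x , n≢c₃ = avoid₂ z x c₃
        m , z~m , m≢x , m≢c₄ = avoid₂ z x c₄
        n₄ = third z~n n≢x (λ n₃ → n≢c₃ (only₃ z~n (symm n₃)))
        m₃ = fourth z~m m≢x (λ m₄ → m≢c₄ (only₄ z~m (symm m₄)))
    in fork-impossible (rotate² c) (rotate²-Z c z∈Z)
         (attach-X (rotate² c) m₃ (z≢ z~m z₄) (z≢ z~m z₂))
         (attach-X (rotate³ c) n₄ (z≢ z~n z₅) (z≢ z~n z₃)) z~m z~n
    where
    open FiveCycle c
    z≢ : ∀ {n v} → z ~ n → z ≁ v → n ≢ v
    z≢ z~n z≁v = apart (symm z~n) (≁-sym z≁v)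
    n₁ : ∀ {n} → z ~ n → n ≢ x → n ≁ v₁
    n₁ z~n n≢x = ≁-sym (unrelated (apart e₁₂ z₂) (≁-sym z₁) (symm x₁) (symm x~z) z~n n≢x)
    n₂ : ∀ {n} → z ~ n → n ≁ v₂
    n₂ z~n n₂ = fork-impossible c z∈Z x∈X (attach-X (rotate c) n₂ (z≢ z~n z₃) (z≢ z~n z₁)) (symm x~z) z~n
    n₅ : ∀ {n} → z ~ n → n ≁ v₅
    n₅ z~n n₅ = fork-impossible (reflect c) (reflect-Z c z∈Z) (reflect-X c x∈X)
      (attach-X (rotate (reflect c)) n₅ (z≢ z~n z₄) (z≢ z~n z₁)) (symm x~z) z~n
    third : ∀ {n} → z ~ n → n ≢ x → n ≁ v₃ → n ~ v₄
    third z~n n≢x n₃ = decidable-stable (adj? _ v₄) λ n₄ →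
      Z-isolated c z∈Z (n₁ z~n n≢x , n₂ z~n , n₃ , n₄ , n₅ z~n) z~n (symm x~z) x₁
    fourth : ∀ {n} → z ~ n → n ≢ x → n ≁ v₄ → n ~ v₃
    fourth z~n n≢x n₄ = decidable-stable (adj? _ v₃) λ n₃ →
      Z-isolated c z∈Z (n₁ z~n n≢x , n₂ z~n , n₃ , n₄ , n₅ z~n) z~n (symm x~z) x₁

  -- A neighbour of `x` outside N[v₁] misses `v₂` and `v₅` by `X-beside`, and can be chosen to miss
  -- `v₄`. By `X-Z` it is not in Z, which leaves `v₃`.
  X-across : ∀ c {x} → X c x → ∃[ y ] (X (rotate² c) y × x ~ y)
  X-across c {x} x∈X@(x₁ , x₂ , x₃ , x₄ , x₅) =
    let c₄ , only₄ = common-neighbour (apart x₁ n₄₁) x₄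
        n , x~n , v₁≁n , n≢v₁ , n≢c₄ = escape x₁ c₄
        n₂ = X-beside c x∈X x~n n≢v₁
        n₄ = λ e → n≢c₄ (only₄ x~n (symm e))
        n₅ = X-beside (reflect c) (reflect-X c x∈X) x~n n≢v₁
        n₃ = decidable-stable (adj? n v₃) λ n₃ → X-Z c x∈X (≁-sym v₁≁n , n₂ , n₃ , n₄ , n₅) x~n
    in n , (n₃ , n₄ , n₅ , ≁-sym v₁≁n , n₂) , x~n
    where open FiveCycle c

  X-consecutive : ∀ c {x y} → X c x → X (rotate c) y → x ≁ y
  X-consecutive c x∈X y∈X@(_ , _ , _ , y₅ , _) x~y =
    X-beside c x∈X x~y (≢-sym (apart (symm e₅₁) y₅)) (proj₁ y∈X)
    where open FiveCycle c

  -- Let `x` and `x′` be adjacent, with neighbours `y` at `v₃` and `w` at `v₄` respectively. The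
  -- triangle on `x`, `x′`, `v₁` forces a fourth neighbour `u` of `y` besides `v₃`, `x` and some `p`
  -- at `v₅`; it can only attach at `v₃`. Then `u y x x′ w v₄ v₅` is an induced P₇.
  X-independent : ∀ c {x x′} → X c x → X c x′ → x ≁ x′
  X-independent c {x} {x′} x∈X@(x₁ , x₂ , x₃ , x₄ , x₅) x′∈X@(x′₁ , x′₂ , x′₃ , x′₄ , x′₅) x~x′ =
    let y  , y∈X@(y₃ , y₄ , y₅ , y₁ , y₂) , x~y = X-across c x∈X
        w  , (w₄ , w₃ , w₂ , w₁ , w₅) , x′~w = X-across (reflect c) (reflect-X c x′∈X)
        w∈X : X (rotate³ c) w
        w∈X = w₄ , w₅ , w₁ , w₂ , w₃
        p  , (p₅ , p₁ , p₂ , p₃ , p₄) , y~p = X-across (rotate² c) y∈X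
        u , y~u , u≢v₃ , u≢x , u≢p = avoid₃ x₁ x~x′ (symm x′₁) y v₃ x p
        u₄ = X-beside (rotate² c) y∈X y~u u≢v₃
        u₂ = X-beside (reflect (rotate² c)) (reflect-X (rotate² c) y∈X) y~u u≢v₃
        u₁ = λ e → u≢x (unique-common (apart y₃ n₁₃) y₁ y~u (symm e) (symm x~y) (symm x₁))
        u₅ = λ e → u≢p (unique-common (≢-sym (apart e₅₁ y₁)) y₅ y~u (symm e) y~p (symm p₅))
        u₃ = decidable-stable (adj? u v₃) λ u₃ → X-Z (rotate² c) y∈X (u₃ , u₄ , u₅ , u₁ , u₂) y~u
        u∈X : X (rotate² c) u
        u∈X = u₃ , u₄ , u₅ , u₁ , u₂
        y≁x′ = λ y~x′ → ~⇒≢ x~x′ (unique-common (apart y₃ n₁₃) y₁ (symm x~y) (symm x₁) y~x′ (symm x′₁))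
        u≁x  = λ u~x → ~⇒≢ y~u (unique-common (≢-sym (apart (symm e₂₃) x₂)) x₃ x~y (symm y₃) (symm u~x) (symm u₃))
        u≁x′ = λ u~x′ → u≢x (unique-common (apart y₃ x′₃) y≁x′ y~u (symm u~x′) (symm x~y) (symm x~x′))
        x≁w  = λ x~w → ~⇒≢ x~x′ (unique-common (apart w₄ (≁-sym n₄₁)) w₁ (symm x~w) (symm x₁) (symm x′~w) (symm x′₁))
    in no-P₇ u y x x′ w v₄ v₅
      ( (symm y~u ∷ u≁x ∷ u≁x′ ∷ X-consecutive (rotate² c) u∈X w∈X ∷ u₄ ∷ u₅ ∷ [])
      ∷ (symm x~y ∷ y≁x′ ∷ X-consecutive (rotate² c) y∈X w∈X ∷ y₄ ∷ y₅ ∷ [])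
      ∷ (x~x′ ∷ x≁w ∷ x₄ ∷ x₅ ∷ [])
      ∷ (x′~w ∷ x′₄ ∷ x′₅ ∷ [])
      ∷ (w₄ ∷ w₅ ∷ [])
      ∷ (e₄₅ ∷ [])
      ∷ [] ∷ [])
    where open FiveCycle c

  -- The three colour classes

  -- A record rather than a bare function type, so that `P` and `Q` can be inferred.
  record Apart (P Q : Pred (V G) 0ℓ) : Set where
    constructor nonadjacent
    field separate : ∀ {u w} → P u → Q w → u ≁ w

  open Apart

  apart-sym : ∀ {P Q} → Apart P Q → Apart Q P
  apart-sym pq = nonadjacent λ q p → ≁-sym (separate pq p q)

  apart-∪ˡ : ∀ {P Q R} → Apart P R → Apart Q R → Apart (P ∪ Q) R
  apart-∪ˡ pr qr = nonadjacent λ { (inj₁ p) r → separate pr p r ; (inj₂ q) r → separate qr q r }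

  apart-∪ʳ : ∀ {P Q R} → Apart P Q → Apart P R → Apart P (Q ∪ R)
  apart-∪ʳ pq pr = apart-sym (apart-∪ˡ (apart-sym pq) (apart-sym pr))

  independent-∪ : ∀ {P Q} → Apart P P → Apart Q Q → Apart P Q → Apart (P ∪ Q) (P ∪ Q)
  independent-∪ pp qq pq = apart-∪ˡ (apart-∪ʳ pp pq) (apart-∪ʳ (apart-sym pq) qq)

  apart-≡ : ∀ {v} {Q : Pred (V G) 0ℓ} → (∀ {w} → Q w → w ≁ v) → Apart (_≡ v) Q
  apart-≡ q≁v = nonadjacent λ { refl q → ≁-sym (q≁v q) }

  independent-≡ : ∀ {v} → Apart (_≡ v) (_≡ v)
  independent-≡ = nonadjacent λ { refl refl → irrefl refl }

  module Colouring (c : FiveCycle) where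
    open FiveCycle c

    -- A 3-colouring of the Petersen graph pulled back: the `vᵢ` form the outer cycle, and the class
    -- X at `vᵢ` can meet only `vᵢ` and the classes two steps away.
    Red Green Blue : Pred (V G) 0ℓ
    Red   = ((_≡ v₁) ∪ (_≡ v₃)) ∪ X (rotate c)
    Green = ((_≡ v₂) ∪ (_≡ v₄)) ∪ (X c ∪ X (rotate⁴ c))
    Blue  = (_≡ v₅) ∪ (X (rotate² c) ∪ X (rotate³ c))

    red : Apart Red Red
    red = independent-∪
      (independent-∪ independent-≡ independent-≡ (apart-≡ λ { refl → ≁-sym n₁₃ }))
      (nonadjacent (X-independent (rotate c)))
      (apart-∪ˡ (apart-≡ λ (_ , _ , _ , _ , x₁) → x₁) (apart-≡ λ (_ , x₃ , _) → x₃))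

    green : Apart Green Green
    green = independent-∪
      (independent-∪ independent-≡ independent-≡ (apart-≡ λ { refl → ≁-sym n₂₄ }))
      (independent-∪ (nonadjacent (X-independent c)) (nonadjacent (X-independent (rotate⁴ c)))
        (apart-sym (nonadjacent (X-consecutive (rotate⁴ c)))))
      (apart-∪ˡ
        (apart-∪ʳ (apart-≡ λ (_ , x₂ , _) → x₂) (apart-≡ λ (_ , _ , x₂ , _) → x₂))
        (apart-∪ʳ (apart-≡ λ (_ , _ , _ , x₄ , _) → x₄) (apart-≡ λ (_ , _ , _ , _ , x₄) → x₄)))

    blue : Apart Blue Blue
    blue = independent-∪ independent-≡
      (independent-∪ (nonadjacent (X-independent (rotate² c))) (nonadjacent (X-independent (rotate³ c)))
        (nonadjacent (X-consecutive (rotate² c))))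
      (apart-∪ʳ (apart-≡ λ (_ , _ , x₅ , _) → x₅) (apart-≡ λ (_ , x₅ , _) → x₅))

    Z-apart : Apart (Red ∪ (Green ∪ Blue)) (Z c)
    Z-apart = apart-∪ˡ
      (apart-∪ˡ
        (apart-∪ˡ (apart-≡ λ (z₁ , _) → z₁) (apart-≡ λ (_ , _ , z₃ , _) → z₃))
        (X-apart (rotate c) (rotate-Z c)))
      (apart-∪ˡ
        (apart-∪ˡ
          (apart-∪ˡ (apart-≡ λ (_ , z₂ , _) → z₂) (apart-≡ λ (_ , _ , _ , z₄ , _) → z₄))
          (apart-∪ˡ (X-apart c id) (X-apart (rotate⁴ c) (rotate⁴-Z c))))
        (apart-∪ˡ (apart-≡ λ (_ , _ , _ , _ , z₅) → z₅)
          (apart-∪ˡ (X-apart (rotate² c) (rotate²-Z c))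
                    (X-apart (rotate³ c) (rotate³-Z c)))))
      where
      X-apart : ∀ d → (∀ {u} → Z c u → Z d u) → Apart (X d) (Z c)
      X-apart d Z⊆ = nonadjacent λ x z → X-Z d x (Z⊆ z)

    covered : ∀ u → ¬ Z c u → (Red ∪ Green ∪ Blue) u
    covered u u∉Z with u ≟ᶠ v₁ | u ≟ᶠ v₂ | u ≟ᶠ v₃ | u ≟ᶠ v₄ | u ≟ᶠ v₅
    ... | yes e | _ | _ | _ | _ = inj₁ (inj₁ (inj₁ e))
    ... | _ | yes e | _ | _ | _ = inj₂ (inj₁ (inj₁ (inj₁ e)))
    ... | _ | _ | yes e | _ | _ = inj₁ (inj₁ (inj₂ e))
    ... | _ | _ | _ | yes e | _ = inj₂ (inj₁ (inj₁ (inj₂ e)))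
    ... | _ | _ | _ | _ | yes e = inj₂ (inj₂ (inj₁ e))
    ... | no u≢v₁ | no u≢v₂ | no u≢v₃ | no u≢v₄ | no u≢v₅
      with adj? u v₁ | adj? u v₂ | adj? u v₃ | adj? u v₄ | adj? u v₅
    ... | yes u₁ | _ | _ | _ | _ = inj₂ (inj₁ (inj₂ (inj₁ (attach-X c u₁ u≢v₂ u≢v₅))))
    ... | _ | yes u₂ | _ | _ | _ = inj₁ (inj₂ (attach-X (rotate c) u₂ u≢v₃ u≢v₁))
    ... | _ | _ | yes u₃ | _ | _ = inj₂ (inj₂ (inj₂ (inj₁ (attach-X (rotate² c) u₃ u≢v₄ u≢v₂))))
    ... | _ | _ | _ | yes u₄ | _ = inj₂ (inj₂ (inj₂ (inj₂ (attach-X (rotate³ c) u₄ u≢v₅ u≢v₃))))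
    ... | _ | _ | _ | _ | yes u₅ = inj₂ (inj₁ (inj₂ (inj₂ (attach-X (rotate⁴ c) u₅ u≢v₁ u≢v₄))))
    ... | no u₁ | no u₂ | no u₃ | no u₄ | no u₅ = contradiction (u₁ , u₂ , u₃ , u₄ , u₅) u∉Z

  -- Finding a five-cycle

  reflect₆ : SixCycle → SixCycle
  reflect₆ h = record
    { e₁₂ = symm e₆₁ ; e₂₃ = symm e₅₆ ; e₃₄ = symm e₄₅ ; e₄₅ = symm e₃₄ ; e₅₆ = symm e₂₃ ; e₆₁ = symm e₁₂
    ; n₁₃ = ≁-sym n₅₁ ; n₂₄ = ≁-sym n₄₆ ; n₃₅ = ≁-sym n₃₅ ; n₄₆ = ≁-sym n₂₄ ; n₅₁ = ≁-sym n₁₃ ; n₆₂ = ≁-sym n₆₂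
    ; n₁₄ = n₁₄ ; n₂₅ = ≁-sym n₃₆ ; n₃₆ = ≁-sym n₂₅ }
    where open SixCycle h

  X₆ A₆ : SixCycle → Pred (V G) 0ℓ
  X₆ h u = u ~ v₁ × u ≁ v₂ × u ≁ v₃ × u ≁ v₄ × u ≁ v₅ × u ≁ v₆   where open SixCycle h
  A₆ h u = u ~ v₁ × u ~ v₂ × u ≁ v₃ × u ≁ v₄ × u ≁ v₅ × u ≁ v₆   where open SixCycle h

  -- A neighbour `n` of `x` outside N[v₁] that misses `v₄` closes a C₅ through `v₃` or `v₅`, or else
  -- begins the induced P₇ `n x v₁ v₂ v₃ v₄ v₅`.
  X₆⇒fiveCycle : ∀ h {x} → X₆ h x → FiveCycle
  X₆⇒fiveCycle h {x} (x₁ , x₂ , x₃ , x₄ , x₅ , x₆) =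
    let c₄ , only₄ = common-neighbour (apart x₁ (≁-sym n₁₄)) x₄
        n , x~n , v₁≁n , n≢v₁ , n≢c₄ = escape x₁ c₄
    in go x~n v₁≁n n≢v₁ (λ e → n≢c₄ (only₄ x~n (symm e)))
    where
    open SixCycle h
    go : ∀ {n} → x ~ n → v₁ ≁ n → n ≢ v₁ → n ≁ v₄ → FiveCycle
    go {n} x~n v₁≁n n≢v₁ n₄ = result (adj? n v₃) (adj? n v₅)
      where
      v₂≁n = unrelated (apart e₂₃ x₃) (≁-sym x₂) (symm e₁₂) x₁ x~n n≢v₁
      v₆≁n = unrelated (apart (symm e₅₆) x₅) (≁-sym x₆) e₆₁ x₁ x~n n≢v₁
      result : Dec (n ~ v₃) → Dec (n ~ v₅) → FiveCycle
      result (yes n₃) _ = record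
        { e₁₂ = x₁ ; e₂₃ = e₁₂ ; e₃₄ = e₂₃ ; e₄₅ = symm n₃ ; e₅₁ = symm x~n
        ; n₁₃ = x₂ ; n₂₄ = n₁₃ ; n₃₅ = v₂≁n ; n₄₁ = ≁-sym x₃ ; n₅₂ = ≁-sym v₁≁n }
      result (no _) (yes n₅) = record
        { e₁₂ = x₁ ; e₂₃ = symm e₆₁ ; e₃₄ = symm e₅₆ ; e₄₅ = symm n₅ ; e₅₁ = symm x~n
        ; n₁₃ = x₆ ; n₂₄ = ≁-sym n₅₁ ; n₃₅ = v₆≁n ; n₄₁ = ≁-sym x₅ ; n₅₂ = ≁-sym v₁≁n }
      result (no n₃) (no n₅) = ⊥-elim (no-P₇ n x v₁ v₂ v₃ v₄ v₅
        ( (symm x~n ∷ ≁-sym v₁≁n ∷ ≁-sym v₂≁n ∷ n₃ ∷ n₄ ∷ n₅ ∷ [])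
        ∷ (x₁ ∷ x₂ ∷ x₃ ∷ x₄ ∷ x₅ ∷ [])
        ∷ (e₁₂ ∷ n₁₃ ∷ n₁₄ ∷ ≁-sym n₅₁ ∷ [])
        ∷ (e₂₃ ∷ n₂₄ ∷ n₂₅ ∷ [])
        ∷ (e₃₄ ∷ n₃₅ ∷ [])
        ∷ (e₄₅ ∷ [])
        ∷ [] ∷ []))

  -- A neighbour `n` of `a` outside N[v₁] closes a C₅ through `v₄` or `v₅`, or else begins the
  -- induced P₇ `n a v₂ v₃ v₄ v₅ v₆`.
  A₆⇒fiveCycle : ∀ h {a} → A₆ h a → FiveCycle
  A₆⇒fiveCycle h {a} (a₁ , a₂ , a₃ , a₄ , a₅ , a₆) =
    -- The second `a` only fills the slot of a vertex to avoid.
    let n , a~n , v₁≁n , n≢v₁ , _ = escape a₁ a in go a~n v₁≁n n≢v₁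
    where
    open SixCycle h
    go : ∀ {n} → a ~ n → v₁ ≁ n → n ≢ v₁ → FiveCycle
    go {n} a~n v₁≁n n≢v₁ = result (adj? n v₄) (adj? n v₅)
      where
      n₂ : n ≁ v₂
      n₂ n~v₂ = ~⇒≢ a₂ (unique-common n≢v₁ (≁-sym v₁≁n) (symm a~n) (symm a₁) n~v₂ e₁₂)
      v₃≁n = unrelated (apart e₃₄ a₄) (≁-sym a₃) (symm e₂₃) a₂ a~n λ { refl → v₁≁n e₁₂ }
      v₆≁n = unrelated (apart (symm e₅₆) a₅) (≁-sym a₆) e₆₁ a₁ a~n n≢v₁
      result : Dec (n ~ v₄) → Dec (n ~ v₅) → FiveCycle
      result (yes n₄) _ = record
        { e₁₂ = a₂ ; e₂₃ = e₂₃ ; e₃₄ = e₃₄ ; e₄₅ = symm n₄ ; e₅₁ = symm a~n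
        ; n₁₃ = a₃ ; n₂₄ = n₂₄ ; n₃₅ = v₃≁n ; n₄₁ = ≁-sym a₄ ; n₅₂ = n₂ }
      result (no _) (yes n₅) = record
        { e₁₂ = a₁ ; e₂₃ = symm e₆₁ ; e₃₄ = symm e₅₆ ; e₄₅ = symm n₅ ; e₅₁ = symm a~n
        ; n₁₃ = a₆ ; n₂₄ = ≁-sym n₅₁ ; n₃₅ = v₆≁n ; n₄₁ = ≁-sym a₅ ; n₅₂ = ≁-sym v₁≁n }
      result (no n₄) (no n₅) = ⊥-elim (no-P₇ n a v₂ v₃ v₄ v₅ v₆
        ( (symm a~n ∷ n₂ ∷ ≁-sym v₃≁n ∷ n₄ ∷ n₅ ∷ ≁-sym v₆≁n ∷ [])
        ∷ (a₂ ∷ a₃ ∷ a₄ ∷ a₅ ∷ a₆ ∷ [])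
        ∷ (e₂₃ ∷ n₂₄ ∷ n₂₅ ∷ ≁-sym n₆₂ ∷ [])
        ∷ (e₃₄ ∷ n₃₅ ∷ n₃₆ ∷ [])
        ∷ (e₄₅ ∷ n₄₆ ∷ [])
        ∷ (e₅₆ ∷ [])
        ∷ [] ∷ []))

  -- A third neighbour `x` of `v₁` misses `v₃` and `v₅`. If it sees the opposite vertex `v₄`, half
  -- of the hexagon closes to a C₅. It cannot see both `v₂` and `v₆`, so the other cases are X₆ and
  -- A₆ up to reflection.
  sixCycle⇒fiveCycle : SixCycle → FiveCycle
  sixCycle⇒fiveCycle h = let x , v₁~x , x≢v₂ , x≢v₆ = avoid₂ v₁ v₂ v₆ in go (symm v₁~x) x≢v₂ x≢v₆
    where
    open SixCycle h
    go : ∀ {x} → x ~ v₁ → x ≢ v₂ → x ≢ v₆ → FiveCycle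
    go {x} x₁ x≢v₂ x≢v₆ = result (adj? x v₄) (adj? x v₂) (adj? x v₆)
      where
      x₃ : x ≁ v₃
      x₃ e = x≢v₂ (unique-common (apart (symm e₆₁) n₃₆) n₁₃ (symm x₁) (symm e) e₁₂ (symm e₂₃))
      x₅ : x ≁ v₅
      x₅ e = x≢v₆ (unique-common (apart e₁₂ (≁-sym n₂₅)) (≁-sym n₅₁) (symm x₁) (symm e) (symm e₆₁) e₅₆)
      result : Dec (x ~ v₄) → Dec (x ~ v₂) → Dec (x ~ v₆) → FiveCycle
      result (yes x₄) _ _ = record
        { e₁₂ = x₁ ; e₂₃ = e₁₂ ; e₃₄ = e₂₃ ; e₄₅ = e₃₄ ; e₅₁ = symm x₄
        ; n₁₃ = λ x₂ → apart x₁ (≁-sym n₁₃) (unique-common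
            (apart (symm e₁₂) (≁-sym n₁₄)) n₂₄ (symm x₂) (symm x₄) e₂₃ (symm e₃₄))
        ; n₂₄ = n₁₃ ; n₃₅ = n₂₄ ; n₄₁ = ≁-sym x₃ ; n₅₂ = ≁-sym n₁₄ }
      result (no x₄) (no  x₂) (no  x₆) = X₆⇒fiveCycle h (x₁ , x₂ , x₃ , x₄ , x₅ , x₆)
      result (no x₄) (yes x₂) (no  x₆) = A₆⇒fiveCycle h (x₁ , x₂ , x₃ , x₄ , x₅ , x₆)
      result (no x₄) (no  x₂) (yes x₆) = A₆⇒fiveCycle (reflect₆ h) (x₁ , x₆ , x₅ , x₄ , x₃ , x₂)
      result (no x₄) (yes x₂) (yes x₆) = contradiction
        (unique-common (apart e₂₃ (≁-sym n₃₆)) (≁-sym n₆₂) (symm x₂) (symm x₆) (symm e₁₂) e₆₁) (~⇒≢ x₁)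

  -- Escaping repeatedly at the end of an induced path either closes a cycle or reaches P₇.
  fiveCycle : V G → FiveCycle
  fiveCycle a =
    let b , a~b , _ = avoid₂ a a a
        c , b~c , a≁c , c≢a , _ = escape (symm a~b) a
        d , c~d , b≁d , d≢b , _ = escape (symm b~c) a
        e , d~e , c≁e , e≢c , _ = escape (symm c~d) a
        f , e~f , d≁f , f≢d , _ = escape (symm d~e) a
        g , f~g , e≁g , g≢e , _ = escape (symm e~f) a
        a≁d = unrelated (≢-sym c≢a) a≁c a~b (symm b~c) c~d d≢b
        b≁e = unrelated (≢-sym d≢b) b≁d b~c (symm c~d) d~e e≢c
        c≁f = unrelated (≢-sym e≢c) c≁e c~d (symm d~e) e~f f≢d
        d≁g = unrelated (≢-sym f≢d) d≁f d~e (symm e~f) f~g g≢e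
        five : ∀ {p q r s t} → p ~ q → q ~ r → r ~ s → s ~ t → t ~ p →
               p ≁ r → q ≁ s → r ≁ t → p ≁ s → q ≁ t → FiveCycle
        five p~q q~r r~s s~t t~p p≁r q≁s r≁t p≁s q≁t = record
          { e₁₂ = p~q ; e₂₃ = q~r ; e₃₄ = r~s ; e₄₅ = s~t ; e₅₁ = t~p
          ; n₁₃ = p≁r ; n₂₄ = q≁s ; n₃₅ = r≁t ; n₄₁ = ≁-sym p≁s ; n₅₂ = ≁-sym q≁t }
        six : ∀ {p q r s t u} → p ~ q → q ~ r → r ~ s → s ~ t → t ~ u → u ~ p →
              p ≁ r → q ≁ s → r ≁ t → s ≁ u → p ≁ s → q ≁ t → r ≁ u → p ≁ t → q ≁ u → FiveCycle
        six p~q q~r r~s s~t t~u u~p p≁r q≁s r≁t s≁u p≁s q≁t r≁u p≁t q≁u = sixCycle⇒fiveCycle record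
          { e₁₂ = p~q ; e₂₃ = q~r ; e₃₄ = r~s ; e₄₅ = s~t ; e₅₆ = t~u ; e₆₁ = u~p
          ; n₁₃ = p≁r ; n₂₄ = q≁s ; n₃₅ = r≁t ; n₄₆ = s≁u ; n₅₁ = ≁-sym p≁t ; n₆₂ = ≁-sym q≁u
          ; n₁₄ = p≁s ; n₂₅ = q≁t ; n₃₆ = r≁u }
        result : Dec (a ~ e) → Dec (b ~ f) → Dec (c ~ g) → Dec (a ~ f) → Dec (b ~ g) → Dec (a ~ g) → FiveCycle
        result = λ where
          (yes a~e) _ _ _ _ _ → five a~b b~c c~d d~e (symm a~e) a≁c b≁d c≁e a≁d b≁e
          (no a≁e) (yes b~f) _ _ _ _ → five b~c c~d d~e e~f (symm b~f) b≁d c≁e d≁f b≁e c≁f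
          (no a≁e) (no b≁f) (yes c~g) _ _ _ → five c~d d~e e~f f~g (symm c~g) c≁e d≁f e≁g c≁f d≁g
          (no a≁e) (no b≁f) (no c≁g) (yes a~f) _ _ →
            six a~b b~c c~d d~e e~f (symm a~f) a≁c b≁d c≁e d≁f a≁d b≁e c≁f a≁e b≁f
          (no a≁e) (no b≁f) (no c≁g) (no a≁f) (yes b~g) _ →
            six b~c c~d d~e e~f f~g (symm b~g) b≁d c≁e d≁f e≁g b≁e c≁f d≁g b≁f c≁g
          (no a≁e) (no b≁f) (no c≁g) (no a≁f) (no b≁g) (yes a~g) → ⊥-elim (no-C₇ a b c d e f g
            ( (a~b ∷ a≁c ∷ a≁d ∷ a≁e ∷ a≁f ∷ a~g ∷ [])
            ∷ (b~c ∷ b≁d ∷ b≁e ∷ b≁f ∷ b≁g ∷ [])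
            ∷ (c~d ∷ c≁e ∷ c≁f ∷ c≁g ∷ [])
            ∷ (d~e ∷ d≁f ∷ d≁g ∷ [])
            ∷ (e~f ∷ e≁g ∷ [])
            ∷ (f~g ∷ [])
            ∷ [] ∷ []))
          (no a≁e) (no b≁f) (no c≁g) (no a≁f) (no b≁g) (no a≁g) → ⊥-elim (no-P₇ a b c d e f g
            ( (a~b ∷ a≁c ∷ a≁d ∷ a≁e ∷ a≁f ∷ a≁g ∷ [])
            ∷ (b~c ∷ b≁d ∷ b≁e ∷ b≁f ∷ b≁g ∷ [])
            ∷ (c~d ∷ c≁e ∷ c≁f ∷ c≁g ∷ [])
            ∷ (d~e ∷ d≁f ∷ d≁g ∷ [])
            ∷ (e~f ∷ e≁g ∷ [])
            ∷ (f~g ∷ [])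
            ∷ [] ∷ []))
    in result (adj? a e) (adj? b f) (adj? c g) (adj? a f) (adj? b g) (adj? a g)

-- Removing vertices

module _ {r : ℕ} (G : Graph) (bound : CliqueBound r G)
         (¬C₄ : ¬ C 4 InducedIn G) (¬diamond : ¬ diamond InducedIn G) where
  open Graph G hiding (V)
  open NoShortCycles G ¬C₄ ¬diamond

  -- In each case the list of forbidden vertices is no longer than some clique, hence than `r`: an
  -- edge for `avoid₂`, a triangle for `avoid₃`, and an edge with its common neighbours for
  -- `escape`.
  irreducible : (∀ v → r < length (neighbours G v)) → Irreducible G
  irreducible deg = record { avoid₂ = avoid₂ ; avoid₃ = avoid₃ ; escape = escape }
    where
    outside : ∀ v {ys} → length ys ≤ r → ∃[ n ] (v ~ n × n ∉ ys)
    outside v ys≤r with avoid (Unique.filter⁺ (adj? v) (Unique.allFin⁺ order)) (≤-trans (s≤s ys≤r) (deg v))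
    ... | n , n∈N , n∉ys = n , proj₂ (∈-filter⁻ (adj? v) {xs = allFin order} n∈N) , n∉ys

    avoid₂ : ∀ v a b → ∃[ n ] (v ~ n × n ≢ a × n ≢ b)
    avoid₂ v a b =
      -- `u` is found only to exhibit an edge, which gives `2 ≤ r`.
      let u , v~u , _ = outside v {[]} z≤n
          n , v~n , n∉ = outside v {a ∷ b ∷ []} (bound ((v~u ∷ []) ∷ [] ∷ []))
      in n , v~n , (λ e → n∉ (here e)) , (λ e → n∉ (there (here e)))

    avoid₃ : ∀ {p q s} → p ~ q → p ~ s → q ~ s → ∀ v a b d → ∃[ n ] (v ~ n × n ≢ a × n ≢ b × n ≢ d)
    avoid₃ p~q p~s q~s v a b d =
      let n , v~n , n∉ = outside v {a ∷ b ∷ d ∷ []} (bound ((p~q ∷ p~s ∷ []) ∷ (q~s ∷ []) ∷ [] ∷ []))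
      in n , v~n , (λ e → n∉ (here e)) , (λ e → n∉ (there (here e))) , (λ e → n∉ (there (there (here e))))

    escape : ∀ {v u} → v ~ u → ∀ w → ∃[ n ] (v ~ n × u ≁ n × n ≢ u × n ≢ w)
    escape {v} {u} v~u w =
      -- `w` takes the place of `v` in the clique `v ∷ u ∷ common`: `v` is no neighbour of itself,
      -- so its slot is free.
      let n , v~n , n∉ = outside v {w ∷ u ∷ common} (bound clique)
      in n , v~n , (λ u~n → n∉ (there (there (∈-filter⁺ both? (∈-allFin n) (v~n , u~n))))) ,
         (λ e → n∉ (there (here e))) , (λ e → n∉ (here e))
      where
      both? : Decidable₁ (λ n → v ~ n × u ~ n)
      both? n = adj? v n ×-dec adj? u n
      common : List (V G)
      common = filter both? (allFin order)
      -- Nonadjacent `m` and `n` would have both `v` and `u` as common neighbours.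
      adjacent : ∀ {m n} → v ~ m × u ~ m → v ~ n × u ~ n → m ≢ n → m ~ n
      adjacent {m} {n} (v~m , u~m) (v~n , u~n) m≢n = decidable-stable (adj? m n) λ m≁n →
        ~⇒≢ v~u (unique-common m≢n m≁n (symm v~m) (symm v~n) (symm u~m) (symm u~n))
      clique : AllPairs _~_ (v ∷ u ∷ common)
      clique =
        (v~u ∷ All.map proj₁ (all-filter both? (allFin order))) ∷
        All.map proj₂ (all-filter both? (allFin order)) ∷
        allPairs-unique adjacent (Unique.filter⁺ both? (Unique.allFin⁺ order)) (all-filter both? (allFin order))

extend-vertex : ∀ G v {r} → length (neighbours G v) ≤ r →
                Colorable (Restriction.restrict G (λ u → ¬? (u ≟ᶠ v))) (suc r) → Colorable G (suc r)
extend-vertex G v {r} N≤r (c , proper) = colour , colour-proper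
  where
  open Graph G hiding (V)
  open Restriction G (λ u → ¬? (u ≟ᶠ v))
  recolour : Fin (suc r) → ∀ u → Dec (u ≡ v) → Fin (suc r)
  recolour k u (yes _)  = k
  recolour k u (no u≢v) = c (index-of u≢v)

  -- `zero` is a placeholder for the colour of `v`, which is chosen only afterwards; it never enters
  -- the list, since `v` is not its own neighbour.
  used : List (Fin (suc r))
  used = map (λ u → recolour zero u (u ≟ᶠ v)) (neighbours G v)

  unused : ∃[ k ] (k ∈ allFin (suc r) × k ∉ used)
  unused = avoid (Unique.allFin⁺ (suc r))
    (subst₂ _<_ (sym (length-map _ (neighbours G v))) (sym (length-tabulate id)) (s≤s N≤r))

  colour : V G → Fin (suc r)
  colour u = recolour (proj₁ unused) u (u ≟ᶠ v)

  fresh : ∀ {u} → u ≢ v → Adj v u → proj₁ unused ≢ colour u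
  fresh {u} u≢v v~u free≡ with ∈-map⁺ (λ u → recolour zero u (u ≟ᶠ v)) (∈-filter⁺ (adj? v) (∈-allFin u) v~u)
  ... | u∈used with u ≟ᶠ v
  ...   | yes u≡v = u≢v u≡v
  ...   | no _    = proj₂ (proj₂ unused) (subst (_∈ used) (sym free≡) u∈used)

  colour-proper : ProperColoring G colour
  colour-proper u w u~w with u ≟ᶠ v | w ≟ᶠ v | fresh {u} | fresh {w}
  ... | yes refl | yes refl | _ | _ = contradiction u~w (irrefl refl)
  ... | yes refl | no w≢v   | _ | f = f w≢v u~w
  ... | no u≢v   | yes refl | f | _ = f u≢v (symm u~w) ∘ sym
  ... | no u≢v   | no w≢v   | _ | _ = index-of-proper c proper u≢v w≢v u~w

module _ (G : Graph) (¬P₇ : ¬ P 7 InducedIn G) (¬C₇ : ¬ C 7 InducedIn G)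
         (¬C₄ : ¬ C 4 InducedIn G) (¬diamond : ¬ diamond InducedIn G) (irr : Irreducible G) where
  open Graph G hiding (V)
  open NoShortCycles G ¬C₄ ¬diamond
  open Structure G ¬P₇ ¬C₇ ¬C₄ ¬diamond irr

  -- By `Z-apart` no edge joins Z to the other vertices, so three colours already present on Z can
  -- be reused for the three classes.
  extend-cycle : ∀ (c : FiveCycle) {k} →
                 Colorable (Restriction.restrict G (Z? c)) (3 + k) → Colorable G (3 + k)
  extend-cycle c {k} (colour , proper) = (λ u → paint (place u)) , λ u w → paint-proper (place u) (place w)
    where
    open Colouring c
    open Restriction G (Z? c)

    place : ∀ u → (Red ∪ (Green ∪ Blue)) u ⊎ Z c u
    place u with Z? c u
    ... | yes u∈Z = inj₂ u∈Z
    ... | no  u∉Z = inj₁ (covered u u∉Z)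

    paint : ∀ {u} → (Red ∪ (Green ∪ Blue)) u ⊎ Z c u → Fin (3 + k)
    paint (inj₁ (inj₁ _))        = 0F
    paint (inj₁ (inj₂ (inj₁ _))) = 1F
    paint (inj₁ (inj₂ (inj₂ _))) = 2F
    paint (inj₂ u∈Z)             = colour (index-of u∈Z)

    paint-proper : ∀ {u w} (p : (Red ∪ (Green ∪ Blue)) u ⊎ Z c u) (q : (Red ∪ (Green ∪ Blue)) w ⊎ Z c w) →
                   u ~ w → paint p ≢ paint q
    paint-proper (inj₁ p) (inj₂ q) u~w _ = Apart.separate Z-apart p q u~w
    paint-proper (inj₂ p) (inj₁ q) u~w _ = Apart.separate Z-apart q p (symm u~w)
    paint-proper (inj₂ p) (inj₂ q) u~w   = index-of-proper colour proper p q u~w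
    paint-proper (inj₁ (inj₁ p))        (inj₁ (inj₁ q))        u~w _ = Apart.separate red p q u~w
    paint-proper (inj₁ (inj₂ (inj₁ p))) (inj₁ (inj₂ (inj₁ q))) u~w _ = Apart.separate green p q u~w
    paint-proper (inj₁ (inj₂ (inj₂ p))) (inj₁ (inj₂ (inj₂ q))) u~w _ = Apart.separate blue p q u~w
    paint-proper (inj₁ (inj₁ _))        (inj₁ (inj₂ (inj₁ _))) _ ()
    paint-proper (inj₁ (inj₁ _))        (inj₁ (inj₂ (inj₂ _))) _ ()
    paint-proper (inj₁ (inj₂ (inj₁ _))) (inj₁ (inj₁ _))        _ ()
    paint-proper (inj₁ (inj₂ (inj₁ _))) (inj₁ (inj₂ (inj₂ _))) _ ()
    paint-proper (inj₁ (inj₂ (inj₂ _))) (inj₁ (inj₁ _))        _ ()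
    paint-proper (inj₁ (inj₂ (inj₂ _))) (inj₁ (inj₂ (inj₁ _))) _ ()

  extend-structure : ∀ {r} → V G → CliqueBound r G →
    (∀ {Q} (Q? : Decidable₁ Q) {v} → ¬ Q v → Colorable (Restriction.restrict G Q?) (suc r)) →
    Colorable G (suc r)
  -- An edge of the cycle gives `2 ≤ r`, so at least three colours are available; `go` generalises
  -- `r` to match on this.
  extend-structure a bound ih = go (fiveCycle a) (bound ((FiveCycle.e₁₂ (fiveCycle a) ∷ []) ∷ [] ∷ [])) ih
    where
    go : ∀ {r} (c : FiveCycle) → 2 ≤ r →
         (∀ {Q} (Q? : Decidable₁ Q) {v} → ¬ Q v → Colorable (Restriction.restrict G Q?) (suc r)) →
         Colorable G (suc r)
    -- `v₁` is outside Z because it sees `v₂`, so the order drops.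
    go c (s≤s (s≤s _)) ih = extend-cycle c (ih (Z? c) λ (_ , z₂ , _) → z₂ (FiveCycle.e₁₂ c))

-- `n` bounds the order strictly, which makes the induction on the order structural.
colourable : ∀ n G {r} → Graph.order G < n → (P 7 ∷ C 7 ∷ C 4 ∷ diamond ∷ []) -free G →
             CliqueBound r G → Colorable G (suc r)
colourable (suc n) G {r} G<1+n free@(¬P₇ ∷ ¬C₇ ∷ ¬C₄ ∷ ¬diamond ∷ []) bound =
  result (any? λ v → length (neighbours G v) ≤? r) (any? λ _ → yes tt)
  where
  ih : ∀ {Q} (Q? : Decidable₁ Q) {v} → ¬ Q v → Colorable (Restriction.restrict G Q?) (suc r)
  ih Q? ¬q = colourable n restrict (≤-trans (restrict-order ¬q) (≤-pred G<1+n))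
               (restrict-free free) (restrict-cliqueBound bound)
    where open Restriction G Q?
  result : Dec (∃[ v ] length (neighbours G v) ≤ r) → Dec (∃[ v ] ⊤) → Colorable G (suc r)
  result (yes (v , N≤r)) _ = extend-vertex G v N≤r (ih (λ u → ¬? (u ≟ᶠ v)) λ v≢v → v≢v refl)
  result (no none) (yes (a , _)) = extend-structure G ¬P₇ ¬C₇ ¬C₄ ¬diamond
    (irreducible G bound ¬C₄ ¬diamond λ v → ≰⇒> λ N≤r → none (v , N≤r)) a bound ih
  result (no _) (no empty) = (λ _ → zero) , λ u → contradiction (u , tt) empty

theorem5p4 : (G : Graph) → (P 7 ∷ C 7 ∷ C 4 ∷ diamond ∷ []) -free G → χ G ≤ ω G + 1
theorem5p4 G free = proj₂ (proj₂ (chromaticNumber G)) (ω G + 1)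
  (subst (Colorable G) (+-comm 1 (ω G)) (colourable _ G ≤-refl free (cliqueBound-ω G)))
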